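{- $$c_2=\frac{\sqrt{33}+3}{16}\sqrt{30+2\sqrt{33}}.$$
   Context: Let $\mathcal{C}$ be the unit circle in $\mathbb{R}^2$ centered at the origin, let $R=(1,0)$, and let $d(\cdot,\cdot)$ denote Euclidean distance. For $k\in\mathbb{N}$ define $$c_k=\sup_{(T_1,\dots,T_k)\in\mathcal{C}^k}\ \min_\sigma\Big(d(R,T_{\sigma(1)})+\sum_{i=2}^k d(T_{\sigma(i-1)},T_{\sigma(i)})\Big),$$ the minimum being over all permutations $\sigma$ of $\{1,\dots,k\}$. In particular $$c_2=\sup_{(T_1,T_2)\in\mathcal{C}^2}\min\big(d(R,T_1)+d(T_1,T_2),\ d(R,T_2)+d(T_2,T_1)\big).$$ -}

module Defs where

open import Data.Fin using (Fin; zero; suc; inject₁)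
open import Data.Fin.Permutation using (Permutation′; _⟨$⟩ʳ_; insert; id)
open import Data.Integer as ℤ using (+_)
import Data.Integer.Properties as ℤ
open import Data.List using (allFin)
import Data.List as List
open import Data.List.NonEmpty using (List⁺; _∷_; [_]; concatMap; foldr₁)
import Data.List.NonEmpty as List⁺
open import Data.Nat as ℕ using (ℕ; zero; suc; NonZero)
import Data.Nat.Properties as ℕ
open import Data.Product using (Σ; ∃; _×_; _,_; proj₁)
open import Data.Rational as ℚ using (ℚ; 0ℚ; 1ℚ; ½; ∣_∣)
import Data.Rational.Properties as ℚ
import Data.Rational.Unnormalised as ℚᵘ
import Data.Rational.Unnormalised.Properties as ℚᵘ
open import Data.Rational.Solver using (module +-*-Solver)
open import Data.Sum using (inj₁; inj₂)
open import Relation.Binary.PropositionalEquality using (_≡_; refl; sym; trans; cong; cong₂; subst; subst₂)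
open import Relation.Nullary using (Dec; yes; no)
open import Relation.Nullary.Negation using (contradiction)

open +-*-Solver using (solve; _:+_; _:*_; _:-_; :-_; _:=_; con)

0<½ : 0ℚ ℚ.< ½
0<½ = ℚ.positive⁻¹ ½

pos*pos : ∀ {p q} → 0ℚ ℚ.< p → 0ℚ ℚ.< q → 0ℚ ℚ.< p ℚ.* q
pos*pos {p} {q} 0<p 0<q =
  subst (ℚ._< p ℚ.* q) (ℚ.*-zeroʳ p) (ℚ.*-monoʳ-<-pos p {{ℚ.positive 0<p}} 0<q)

*-monoʳ-≤ : ∀ {p q r} → 0ℚ ℚ.≤ r → p ℚ.≤ q → r ℚ.* p ℚ.≤ r ℚ.* q
*-monoʳ-≤ {r = r} 0≤r = ℚ.*-monoˡ-≤-nonNeg r {{ℚ.nonNegative 0≤r}}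

*-mono-≤ : ∀ {p q r s} → 0ℚ ℚ.≤ q → 0ℚ ℚ.≤ r → p ℚ.≤ q → r ℚ.≤ s → p ℚ.* r ℚ.≤ q ℚ.* s
*-mono-≤ {p} {q} {r} {s} 0≤q 0≤r p≤q r≤s =
  ℚ.≤-trans (ℚ.*-monoʳ-≤-nonNeg r {{ℚ.nonNegative 0≤r}} p≤q) (*-monoʳ-≤ 0≤q r≤s)

0<1 : 0ℚ ℚ.< 1ℚ
0<1 = ℚ.positive⁻¹ 1ℚ

0<1+ : ∀ {p} → 0ℚ ℚ.≤ p → 0ℚ ℚ.< 1ℚ ℚ.+ p
0<1+ {p} 0≤p = subst (ℚ._< 1ℚ ℚ.+ p) (ℚ.+-identityʳ 0ℚ) (ℚ.+-mono-<-≤ 0<1 0≤p)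

*-mono-< : ∀ {p q r s} → 0ℚ ℚ.< q → 0ℚ ℚ.≤ r → p ℚ.< q → r ℚ.< s → p ℚ.* r ℚ.< q ℚ.* s
*-mono-< {p} {q} {r} {s} 0<q 0≤r p<q r<s = ℚ.≤-<-trans
  (ℚ.*-monoʳ-≤-nonNeg r {{ℚ.nonNegative 0≤r}} (ℚ.<⇒≤ p<q))
  (ℚ.*-monoʳ-<-pos q {{ℚ.positive 0<q}} r<s)

divide : ∀ {p q} → 0ℚ ℚ.< p → 0ℚ ℚ.< q → ∃ λ r → 0ℚ ℚ.< r × p ℚ.* r ≡ q
divide {p} {q} 0<p 0<q = ℚ.1/ p ℚ.* q
  , pos*pos (ℚ.positive⁻¹ (ℚ.1/ p) {{ℚ.1/pos⇒pos p}}) 0<q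
  , trans (sym (ℚ.*-assoc p (ℚ.1/ p) q)) (trans (cong (ℚ._* q) (ℚ.*-inverseʳ p)) (ℚ.*-identityˡ q))
  where instance
    p>0 = ℚ.positive 0<p
    p≢0 = ℚ.pos⇒nonZero p

∣p∣≤∣p-q∣+∣q∣ : ∀ p q → ∣ p ∣ ℚ.≤ ∣ p ℚ.- q ∣ ℚ.+ ∣ q ∣
∣p∣≤∣p-q∣+∣q∣ p q = subst (λ z → ∣ z ∣ ℚ.≤ ∣ p ℚ.- q ∣ ℚ.+ ∣ q ∣)
  (solve 2 (λ p q → (p :- q) :+ q := p) refl p q) (ℚ.∣p+q∣≤∣p∣+∣q∣ (p ℚ.- q) q)

½+½ : ∀ p → ½ ℚ.* p ℚ.+ ½ ℚ.* p ≡ p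
½+½ = solve 1 (λ p → con ½ :* p :+ con ½ :* p := p) refl

0<q-p⇒p<q : ∀ {p q} → 0ℚ ℚ.< q ℚ.- p → p ℚ.< q
0<q-p⇒p<q {p} {q} h = subst₂ ℚ._<_ (ℚ.+-identityʳ p)
  (solve 2 (λ p q → p :+ (q :- p) := q) refl p q) (ℚ.+-monoʳ-< p h)

p-q<r⇒p<r+q : ∀ {p q r} → p ℚ.- q ℚ.< r → p ℚ.< r ℚ.+ q
p-q<r⇒p<r+q {p} {q} {r} h = subst (ℚ._< r ℚ.+ q)
  (solve 2 (λ p q → (p :- q) :+ q := p) refl p q) (ℚ.+-monoˡ-< q h)

p<r+q⇒p-q<r : ∀ {p q r} → p ℚ.< r ℚ.+ q → p ℚ.- q ℚ.< r
p<r+q⇒p-q<r {p} {q} {r} h = subst (p ℚ.- q ℚ.<_)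
  (solve 2 (λ r q → (r :+ q) :- q := r) refl r q) (ℚ.+-monoˡ-< (ℚ.- q) h)

p≤∣p∣ : ∀ p → p ℚ.≤ ∣ p ∣
p≤∣p∣ p with ℚ.≤-total 0ℚ p
... | inj₁ 0≤p = ℚ.≤-reflexive (sym (ℚ.0≤p⇒∣p∣≡p 0≤p))
... | inj₂ p≤0 = ℚ.≤-trans p≤0 (ℚ.0≤∣p∣ p)

∣p-q∣≡∣q-p∣ : ∀ p q → ∣ p ℚ.- q ∣ ≡ ∣ q ℚ.- p ∣
∣p-q∣≡∣q-p∣ p q = trans (sym (ℚ.∣-p∣≡∣p∣ (p ℚ.- q)))
  (cong ∣_∣ (solve 2 (λ p q → :- (p :- q) := q :- p) refl p q))

∣p-q∣<r⇒p<r+q : ∀ {p q r} → ∣ p ℚ.- q ∣ ℚ.< r → p ℚ.< r ℚ.+ q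
∣p-q∣<r⇒p<r+q {p} {q} h = p-q<r⇒p<r+q (ℚ.≤-<-trans (p≤∣p∣ (p ℚ.- q)) h)

∣p-q∣<r⇒q<r+p : ∀ {p q r} → ∣ p ℚ.- q ∣ ℚ.< r → q ℚ.< r ℚ.+ p
∣p-q∣<r⇒q<r+p {p} {q} {r} h = ∣p-q∣<r⇒p<r+q (subst (ℚ._< r) (∣p-q∣≡∣q-p∣ p q) h)

∣p-q∣<r : ∀ {p q r} → p ℚ.< r ℚ.+ q → q ℚ.< r ℚ.+ p → ∣ p ℚ.- q ∣ ℚ.< r
∣p-q∣<r {p} {q} {r} h₁ h₂ with ℚ.∣p∣≡p∨∣p∣≡-p (p ℚ.- q)
... | inj₁ e = subst (ℚ._< r) (sym e) (p<r+q⇒p-q<r h₁)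
... | inj₂ e = subst (ℚ._< r)
  (trans (solve 2 (λ p q → q :- p := :- (p :- q)) refl p q) (sym e)) (p<r+q⇒p-q<r h₂)

⊓-<-+ : ∀ p q p′ q′ r → p ℚ.< r ℚ.+ p′ → q ℚ.< r ℚ.+ q′ → p ℚ.⊓ q ℚ.< r ℚ.+ (p′ ℚ.⊓ q′)
⊓-<-+ p q p′ q′ r h₁ h₂ with ℚ.≤-total p′ q′
... | inj₁ le = subst (λ z → p ℚ.⊓ q ℚ.< r ℚ.+ z) (sym (ℚ.p≤q⇒p⊓q≡p le)) (ℚ.≤-<-trans (ℚ.p⊓q≤p p q) h₁)
... | inj₂ ge = subst (λ z → p ℚ.⊓ q ℚ.< r ℚ.+ z) (sym (ℚ.p≥q⇒p⊓q≡q ge)) (ℚ.≤-<-trans (ℚ.p⊓q≤q p q) h₂)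

⊓-close : ∀ p q p′ q′ {ε} → ∣ p ℚ.- p′ ∣ ℚ.< ε → ∣ q ℚ.- q′ ∣ ℚ.< ε → ∣ (p ℚ.⊓ q) ℚ.- (p′ ℚ.⊓ q′) ∣ ℚ.< ε
⊓-close p q p′ q′ {ε} h₁ h₂ = ∣p-q∣<r
  (⊓-<-+ p q p′ q′ ε (∣p-q∣<r⇒p<r+q {p} {p′} h₁) (∣p-q∣<r⇒p<r+q {q} {q′} h₂))
  (⊓-<-+ p′ q′ p q ε (∣p-q∣<r⇒q<r+p {p} {p′} h₁) (∣p-q∣<r⇒q<r+p {q} {q′} h₂))

⊔0-<-+ : ∀ p q {r} → 0ℚ ℚ.< r → p ℚ.< r ℚ.+ q → p ℚ.⊔ 0ℚ ℚ.< r ℚ.+ (q ℚ.⊔ 0ℚ)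
⊔0-<-+ p q {r} 0<r h with ℚ.≤-total p 0ℚ
... | inj₂ p≥0 = subst (ℚ._< r ℚ.+ (q ℚ.⊔ 0ℚ)) (sym (ℚ.p≥q⇒p⊔q≡p p≥0))
  (ℚ.<-≤-trans h (ℚ.+-monoʳ-≤ r (ℚ.p≤p⊔q q 0ℚ)))
... | inj₁ p≤0 = subst (ℚ._< r ℚ.+ (q ℚ.⊔ 0ℚ)) (sym (ℚ.p≤q⇒p⊔q≡q p≤0))
  (ℚ.<-≤-trans 0<r (subst (ℚ._≤ r ℚ.+ (q ℚ.⊔ 0ℚ)) (ℚ.+-identityʳ r) (ℚ.+-monoʳ-≤ r (ℚ.p≤q⊔p q 0ℚ))))

∣+-+∣ : ∀ p q p′ q′ → ∣ (p ℚ.+ q) ℚ.- (p′ ℚ.+ q′) ∣ ℚ.≤ ∣ p ℚ.- p′ ∣ ℚ.+ ∣ q ℚ.- q′ ∣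
∣+-+∣ p q p′ q′ = subst (λ z → ∣ z ∣ ℚ.≤ ∣ p ℚ.- p′ ∣ ℚ.+ ∣ q ℚ.- q′ ∣)
  (solve 4 (λ p q p′ q′ → (p :- p′) :+ (q :- q′) := (p :+ q) :- (p′ :+ q′)) refl p q p′ q′)
  (ℚ.∣p+q∣≤∣p∣+∣q∣ (p ℚ.- p′) (q ℚ.- q′))

∣*-*∣ : ∀ p q p′ q′ → ∣ p ℚ.* q ℚ.- p′ ℚ.* q′ ∣ ℚ.≤ ∣ p ∣ ℚ.* ∣ q ℚ.- q′ ∣ ℚ.+ ∣ q′ ∣ ℚ.* ∣ p ℚ.- p′ ∣
∣*-*∣ p q p′ q′ = subst₂ (λ y z → ∣ y ∣ ℚ.≤ z)
  (solve 4 (λ p q p′ q′ → p :* (q :- q′) :+ q′ :* (p :- p′) := p :* q :- p′ :* q′) refl p q p′ q′)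
  (cong₂ ℚ._+_ (ℚ.∣p*q∣≡∣p∣*∣q∣ p (q ℚ.- q′)) (ℚ.∣p*q∣≡∣p∣*∣q∣ q′ (p ℚ.- p′)))
  (ℚ.∣p+q∣≤∣p∣+∣q∣ (p ℚ.* (q ℚ.- q′)) (q′ ℚ.* (p ℚ.- p′)))

*-close : ∀ p q p′ q′ ε {A B δ η} → 0ℚ ℚ.< A → 0ℚ ℚ.< B → A ℚ.* δ ≡ ½ ℚ.* ε → B ℚ.* η ≡ ½ ℚ.* ε →
  ∣ p ∣ ℚ.< A → ∣ q′ ∣ ℚ.< B → ∣ q ℚ.- q′ ∣ ℚ.< δ → ∣ p ℚ.- p′ ∣ ℚ.< η → ∣ p ℚ.* q ℚ.- p′ ℚ.* q′ ∣ ℚ.< ε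
*-close p q p′ q′ ε {A} {B} {δ} {η} 0<A 0<B Aδ≡ Bη≡ hp hq′ hq hp′ =
  ℚ.≤-<-trans (∣*-*∣ p q p′ q′)
    (subst (∣ p ∣ ℚ.* ∣ q ℚ.- q′ ∣ ℚ.+ ∣ q′ ∣ ℚ.* ∣ p ℚ.- p′ ∣ ℚ.<_)
      (trans (cong₂ ℚ._+_ Aδ≡ Bη≡) (½+½ ε))
      (ℚ.+-mono-< {∣ p ∣ ℚ.* ∣ q ℚ.- q′ ∣} {A ℚ.* δ} {∣ q′ ∣ ℚ.* ∣ p ℚ.- p′ ∣} {B ℚ.* η}
        (*-mono-< 0<A (ℚ.0≤∣p∣ (q ℚ.- q′)) hp hq)
        (*-mono-< 0<B (ℚ.0≤∣p∣ (p ℚ.- p′)) hq′ hp′)))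

Cauchy : (ℕ → ℚ) → Set
Cauchy f = ∀ ε → 0ℚ ℚ.< ε → ∃ λ N → ∀ m n → N ℕ.≤ m → N ℕ.≤ n → ∣ f m ℚ.- f n ∣ ℚ.< ε

-- Cauchy sequences with a modulus, compared by the setoid equality _≈_.
-- Without eta and with copattern definitions, conversion checking compares
-- real expressions structurally instead of unfolding their Cauchy proofs.
record ℝ : Set where
  no-eta-equality
  field
    seq    : ℕ → ℚ
    cauchy : Cauchy seq

open ℝ public

infix 4 _≈_ _≤_

_≈_ : ℝ → ℝ → Set
x ≈ y = ∀ ε → 0ℚ ℚ.< ε → ∃ λ N → ∀ n → N ℕ.≤ n → ∣ seq x n ℚ.- seq y n ∣ ℚ.< ε

_≤_ : ℝ → ℝ → Set
x ≤ y = ∀ ε → 0ℚ ℚ.< ε → ∃ λ N → ∀ n → N ℕ.≤ n → seq x n ℚ.< ε ℚ.+ seq y n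

fromℚ : ℚ → ℝ
seq    (fromℚ q) _ = q
cauchy (fromℚ q) ε 0<ε = 0 , λ _ _ _ _ →
  subst (ℚ._< ε) (sym (cong ∣_∣ (ℚ.+-inverseʳ q))) 0<ε

fromℕ : ℕ → ℝ
fromℕ n = fromℚ (+ n ℚ./ 1)

0ℝ 1ℝ : ℝ
0ℝ = fromℚ 0ℚ
1ℝ = fromℚ 1ℚ

infix  8 -_
infixl 7 _*_ _/_ _⊓_
infixl 6 _+_ _-_

_+_ : ℝ → ℝ → ℝ
seq    (x + y) n = seq x n ℚ.+ seq y n
cauchy (x + y) ε 0<ε =
  let 0<δ = pos*pos 0<½ 0<ε
      (M , hM) = cauchy x (½ ℚ.* ε) 0<δ
      (N , hN) = cauchy y (½ ℚ.* ε) 0<δ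
  in M ℕ.⊔ N , λ m n p q →
    ℚ.≤-<-trans (∣+-+∣ (seq x m) (seq y m) (seq x n) (seq y n))
      (subst (∣ seq x m ℚ.- seq x n ∣ ℚ.+ ∣ seq y m ℚ.- seq y n ∣ ℚ.<_) (½+½ ε)
        (ℚ.+-mono-< (hM m n (ℕ.m⊔n≤o⇒m≤o M N p) (ℕ.m⊔n≤o⇒m≤o M N q))
                    (hN m n (ℕ.m⊔n≤o⇒n≤o M N p) (ℕ.m⊔n≤o⇒n≤o M N q))))

-_ : ℝ → ℝ
seq    (- x) n = ℚ.- seq x n
cauchy (- x) ε 0<ε =
  let (N , h) = cauchy x ε 0<ε
  in N , λ m n p q → subst (ℚ._< ε)
    (cong ∣_∣ (solve 2 (λ a b → b :- a := :- a :- :- b) refl (seq x m) (seq x n))) (h n m q p)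

_-_ : ℝ → ℝ → ℝ
x - y = x + - y

eventually-bounded : ∀ x → ∃ λ B → 0ℚ ℚ.< B × ∃ λ N → ∀ n → N ℕ.≤ n → ∣ seq x n ∣ ℚ.< B
eventually-bounded x with cauchy x 1ℚ 0<1
... | N , h = 1ℚ ℚ.+ ∣ seq x N ∣ , 0<1+ (ℚ.0≤∣p∣ (seq x N)) , N , λ n p →
  ℚ.≤-<-trans (∣p∣≤∣p-q∣+∣q∣ (seq x n) (seq x N)) (ℚ.+-monoˡ-< ∣ seq x N ∣ (h n N p ℕ.≤-refl))

*-cauchy : ∀ x y → Cauchy (λ n → seq x n ℚ.* seq y n)
*-cauchy x y ε 0<ε =
  let (A , 0<A , K , hK) = eventually-bounded x
      (B , 0<B , L , hL) = eventually-bounded y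
      (δ , 0<δ , Aδ≡) = divide 0<A (pos*pos 0<½ 0<ε)
      (η , 0<η , Bη≡) = divide 0<B (pos*pos 0<½ 0<ε)
      (M , hM) = cauchy y δ 0<δ
      (N , hN) = cauchy x η 0<η
  in (K ℕ.⊔ L) ℕ.⊔ (M ℕ.⊔ N) , λ m n p q →
    let pKL = ℕ.m⊔n≤o⇒m≤o (K ℕ.⊔ L) (M ℕ.⊔ N) p
        pMN = ℕ.m⊔n≤o⇒n≤o (K ℕ.⊔ L) (M ℕ.⊔ N) p
        qKL = ℕ.m⊔n≤o⇒m≤o (K ℕ.⊔ L) (M ℕ.⊔ N) q
        qMN = ℕ.m⊔n≤o⇒n≤o (K ℕ.⊔ L) (M ℕ.⊔ N) q
    in *-close (seq x m) (seq y m) (seq x n) (seq y n) ε 0<A 0<B Aδ≡ Bη≡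
         (hK m (ℕ.m⊔n≤o⇒m≤o K L pKL)) (hL n (ℕ.m⊔n≤o⇒n≤o K L qKL))
         (hM m n (ℕ.m⊔n≤o⇒m≤o M N pMN) (ℕ.m⊔n≤o⇒m≤o M N qMN))
         (hN m n (ℕ.m⊔n≤o⇒n≤o M N pMN) (ℕ.m⊔n≤o⇒n≤o M N qMN))

_*_ : ℝ → ℝ → ℝ
seq    (x * y) n = seq x n ℚ.* seq y n
cauchy (x * y)   = *-cauchy x y

_/_ : ℝ → (d : ℕ) → .{{NonZero d}} → ℝ
x / d = x * fromℚ (+ 1 ℚ./ d)

_⊓_ : ℝ → ℝ → ℝ
seq    (x ⊓ y) n = seq x n ℚ.⊓ seq y n
cauchy (x ⊓ y) ε 0<ε =
  let (M , hM) = cauchy x ε 0<ε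
      (N , hN) = cauchy y ε 0<ε
  in M ℕ.⊔ N , λ m n p q → ⊓-close (seq x m) (seq y m) (seq x n) (seq y n)
       (hM m n (ℕ.m⊔n≤o⇒m≤o M N p) (ℕ.m⊔n≤o⇒m≤o M N q))
       (hN m n (ℕ.m⊔n≤o⇒n≤o M N p) (ℕ.m⊔n≤o⇒n≤o M N q))

-- Bisection for the root of q ≥ 0: after n steps it lies in the
-- interval [ lower q n , lower q n + width q n ).

width : ℚ → ℕ → ℚ
width q zero    = q ℚ.+ 1ℚ
width q (suc n) = ½ ℚ.* width q n

next : ∀ q l w → Dec ((l ℚ.+ w) ℚ.* (l ℚ.+ w) ℚ.≤ q) → ℚ
next q l w (yes _) = l ℚ.+ w
next q l w (no  _) = l

lower : ℚ → ℕ → ℚ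
lower q zero    = 0ℚ
lower q (suc n) = next q (lower q n) (width q (suc n)) (_ ℚ.≤? q)

module _ {q : ℚ} (0≤q : 0ℚ ℚ.≤ q) where

  0<width : ∀ n → 0ℚ ℚ.< width q n
  0<width zero    = subst (0ℚ ℚ.<_) (ℚ.+-comm 1ℚ q) (0<1+ 0≤q)
  0<width (suc n) = pos*pos 0<½ (0<width n)

  0≤lower : ∀ n → 0ℚ ℚ.≤ lower q n
  0≤lower zero    = ℚ.≤-refl
  0≤lower (suc n) = step (_ ℚ.≤? q)
    where
    step : ∀ d → 0ℚ ℚ.≤ next q (lower q n) (width q (suc n)) d
    step (yes _) = subst (ℚ._≤ lower q n ℚ.+ width q (suc n)) (ℚ.+-identityˡ 0ℚ)
                     (ℚ.+-mono-≤ (0≤lower n) (ℚ.<⇒≤ (0<width (suc n))))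
    step (no  _) = 0≤lower n

  lower²≤ : ∀ n → lower q n ℚ.* lower q n ℚ.≤ q
  lower²≤ zero    = 0≤q
  lower²≤ (suc n) = step (_ ℚ.≤? q)
    where
    step : ∀ d → let l = next q (lower q n) (width q (suc n)) d in l ℚ.* l ℚ.≤ q
    step (yes h) = h
    step (no  _) = lower²≤ n

  <upper² : ∀ n → q ℚ.< (lower q n ℚ.+ width q n) ℚ.* (lower q n ℚ.+ width q n)
  <upper² zero = 0<q-p⇒p<q (subst (0ℚ ℚ.<_)
    (solve 1 (λ q → con 1ℚ :+ (q :+ q :* q) := (con 0ℚ :+ (q :+ con 1ℚ)) :* (con 0ℚ :+ (q :+ con 1ℚ)) :- q) refl q)
    (0<1+ (subst (ℚ._≤ q ℚ.+ q ℚ.* q) (ℚ.+-identityʳ 0ℚ)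
      (ℚ.+-mono-≤ 0≤q (subst (ℚ._≤ q ℚ.* q) (ℚ.*-zeroʳ q) (*-monoʳ-≤ 0≤q 0≤q))))))
  <upper² (suc n) = step (_ ℚ.≤? q)
    where
    step : ∀ d → let l = next q (lower q n) (width q (suc n)) d; w = width q (suc n) in q ℚ.< (l ℚ.+ w) ℚ.* (l ℚ.+ w)
    step (yes _) = subst (λ z → q ℚ.< z ℚ.* z)
      (solve 2 (λ l w → l :+ w := l :+ con ½ :* w :+ con ½ :* w) refl (lower q n) (width q n)) (<upper² n)
    step (no ¬h) = ℚ.≰⇒> ¬h

ι : ℕ → ℚ
ι zero    = 0ℚ
ι (suc k) = 1ℚ ℚ.+ ι k

toℚᵘ-ι : ∀ k → ℚ.toℚᵘ (ι k) ℚᵘ.≃ ℚᵘ.mkℚᵘ (+ k) 0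
toℚᵘ-ι zero    = ℚᵘ.≃-refl
toℚᵘ-ι (suc k) = ℚᵘ.≃-trans (ℚ.toℚᵘ-homo-+ 1ℚ (ι k))
  (ℚᵘ.≃-trans (ℚᵘ.+-congʳ (ℚ.toℚᵘ 1ℚ) (toℚᵘ-ι k))
    (ℚᵘ.*≡* (cong (ℤ._* (+ 1)) (cong (ℤ._+_ (+ 1)) (ℤ.*-identityʳ (+ k))))))

archimedean : ∀ p → ∃ λ k → p ℚ.≤ ι k
archimedean p@(ℚ.mkℚ n d _) = ℤ.∣ n ∣ , ℚ.toℚᵘ-cancel-≤
  (ℚᵘ.≤-respʳ-≃ (ℚᵘ.≃-sym (toℚᵘ-ι ℤ.∣ n ∣)) (ℚᵘ.*≤* (bound n)))
  where
  bound : ∀ n → n ℤ.* (+ 1) ℤ.≤ (+ ℤ.∣ n ∣) ℤ.* (+ suc d)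
  bound (+ m)        = subst₂ ℤ._≤_ (sym (ℤ.*-identityʳ (+ m))) (ℤ.pos-* m (suc d)) (ℤ.+≤+ (ℕ.m≤m*n m (suc d)))
  bound (ℤ.-[1+ m ]) = subst (ℤ._≤ + suc m ℤ.* + suc d) (sym (ℤ.*-identityʳ ℤ.-[1+ m ])) ℤ.-≤+

width-≤ : ∀ q k {ε} → 0ℚ ℚ.≤ ε → q ℚ.+ 1ℚ ℚ.≤ ι k ℚ.* ε → ∀ n → width q n ℚ.≤ ι (suc (k ℕ.∸ n)) ℚ.* ε
width-≤ q k {ε} 0≤ε h zero = ℚ.≤-trans h (ι-suc-≤ k)
  where
  ι-suc-≤ : ∀ k → ι k ℚ.* ε ℚ.≤ ι (suc k) ℚ.* ε
  ι-suc-≤ k = subst₂ ℚ._≤_ (ℚ.+-identityˡ (ι k ℚ.* ε))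
    (solve 2 (λ e i → e :+ i :* e := (con 1ℚ :+ i) :* e) refl ε (ι k)) (ℚ.+-monoˡ-≤ (ι k ℚ.* ε) 0≤ε)
width-≤ q k {ε} 0≤ε h (suc n) = ℚ.≤-trans
  (*-monoʳ-≤ (ℚ.<⇒≤ 0<½) (width-≤ q k 0≤ε h n))
  (subst (λ j → ½ ℚ.* (ι (suc (k ℕ.∸ n)) ℚ.* ε) ℚ.≤ ι (suc j) ℚ.* ε)
    (ℕ.pred[m∸n]≡m∸[1+n] k n) (halve (k ℕ.∸ n)))
  where
  0≤ι : ∀ j → 0ℚ ℚ.≤ ι j
  0≤ι zero    = ℚ.≤-refl
  0≤ι (suc j) = ℚ.<⇒≤ (0<1+ (0≤ι j))

  halve : ∀ j → ½ ℚ.* (ι (suc j) ℚ.* ε) ℚ.≤ ι (suc (ℕ.pred j)) ℚ.* ε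
  halve zero    = ℚ.≤-trans
    (ℚ.*-monoʳ-≤-nonNeg (ι 1 ℚ.* ε) {{ℚ.nonNegative (subst (ℚ._≤ ι 1 ℚ.* ε) (ℚ.*-zeroʳ (ι 1)) (*-monoʳ-≤ (0≤ι 1) 0≤ε))}} ½≤1)
    (ℚ.≤-reflexive (ℚ.*-identityˡ (ι 1 ℚ.* ε)))
    where
    ½≤1 : ½ ℚ.≤ 1ℚ
    ½≤1 = ℚ.≤ᵇ⇒≤ _
  halve (suc j) = subst₂ ℚ._≤_
    (solve 2 (λ e i → con ½ :* i :* e :+ e := con ½ :* ((con 1ℚ :+ (con 1ℚ :+ i)) :* e)) refl ε (ι j))
    (solve 2 (λ e i → i :* e :+ e := (con 1ℚ :+ i) :* e) refl ε (ι j))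
    (ℚ.+-monoˡ-≤ ε (ℚ.*-monoʳ-≤-nonNeg ε {{ℚ.nonNegative 0≤ε}}
      (subst (½ ℚ.* ι j ℚ.≤_) (½+½ (ι j))
        (subst (ℚ._≤ ½ ℚ.* ι j ℚ.+ ½ ℚ.* ι j) (ℚ.+-identityʳ (½ ℚ.* ι j))
          (ℚ.+-monoʳ-≤ (½ ℚ.* ι j) (subst (ℚ._≤ ½ ℚ.* ι j) (ℚ.*-zeroʳ ½) (*-monoʳ-≤ (ℚ.<⇒≤ 0<½) (0≤ι j))))))))

width-mono : ∀ {p q} → p ℚ.≤ q → ∀ n → width p n ℚ.≤ width q n
width-mono p≤q zero    = ℚ.+-monoˡ-≤ 1ℚ p≤q
width-mono p≤q (suc n) = *-monoʳ-≤ (ℚ.<⇒≤ 0<½) (width-mono p≤q n)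

width-→0 : ∀ q ε → 0ℚ ℚ.< ε → ∃ λ N → ∀ n → N ℕ.≤ n → width q n ℚ.≤ ε
width-→0 q ε 0<ε =
  let (r , εr≡) = quotient
      (k , r≤k) = archimedean r
      q+1≤kε = subst₂ ℚ._≤_ εr≡ (ℚ.*-comm ε (ι k)) (*-monoʳ-≤ (ℚ.<⇒≤ 0<ε) r≤k)
  in k , λ n k≤n → subst (width q n ℚ.≤_)
       (trans (cong (λ j → ι (suc j) ℚ.* ε) (ℕ.m≤n⇒m∸n≡0 k≤n)) (ℚ.*-identityˡ ε))
       (width-≤ q k (ℚ.<⇒≤ 0<ε) q+1≤kε n)
  where
  quotient : ∃ λ r → ε ℚ.* r ≡ q ℚ.+ 1ℚ
  quotient = ℚ.1/ ε ℚ.* (q ℚ.+ 1ℚ) ,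
    trans (sym (ℚ.*-assoc ε (ℚ.1/ ε) (q ℚ.+ 1ℚ)))
      (trans (cong (ℚ._* (q ℚ.+ 1ℚ)) (ℚ.*-inverseʳ ε)) (ℚ.*-identityˡ (q ℚ.+ 1ℚ)))
    where instance
      ε>0 = ℚ.positive 0<ε
      ε≢0 = ℚ.pos⇒nonZero ε

0≤p⊔0 : ∀ p → 0ℚ ℚ.≤ p ℚ.⊔ 0ℚ
0≤p⊔0 p = ℚ.p≤q⊔p p 0ℚ

√-step : ∀ {p q s t w ε} → 0ℚ ℚ.< ε → 0ℚ ℚ.≤ t → 0ℚ ℚ.≤ w →
  s ℚ.* s ℚ.≤ p → q ℚ.< (t ℚ.+ w) ℚ.* (t ℚ.+ w) → w ℚ.≤ ½ ℚ.* ε →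
  p ℚ.< (½ ℚ.* ε) ℚ.* (½ ℚ.* ε) ℚ.+ q → s ℚ.< ε ℚ.+ t
√-step {p} {q} {s} {t} {w} {ε} 0<ε 0≤t 0≤w s²≤p q<u² w≤ p< with s ℚ.<? ε ℚ.+ t
... | yes h = h
... | no ¬h = contradiction (ℚ.<-≤-trans (ℚ.<-trans (ℚ.≤-<-trans s²≤p p<) bound) ε+t²≤s²) (ℚ.<-irrefl refl)
  where
  h = ½ ℚ.* ε
  0<h : 0ℚ ℚ.< h
  0<h = pos*pos 0<½ 0<ε
  0≤t+h : 0ℚ ℚ.≤ t ℚ.+ h
  0≤t+h = subst (ℚ._≤ t ℚ.+ h) (ℚ.+-identityʳ 0ℚ) (ℚ.+-mono-≤ 0≤t (ℚ.<⇒≤ 0<h))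
  0≤ε+t : 0ℚ ℚ.≤ ε ℚ.+ t
  0≤ε+t = subst (ℚ._≤ ε ℚ.+ t) (ℚ.+-identityʳ 0ℚ) (ℚ.+-mono-≤ (ℚ.<⇒≤ 0<ε) 0≤t)
  0≤t+w : 0ℚ ℚ.≤ t ℚ.+ w
  0≤t+w = subst (ℚ._≤ t ℚ.+ w) (ℚ.+-identityʳ 0ℚ) (ℚ.+-mono-≤ 0≤t 0≤w)
  ε+t²≤s² : (ε ℚ.+ t) ℚ.* (ε ℚ.+ t) ℚ.≤ s ℚ.* s
  ε+t²≤s² = *-mono-≤ (ℚ.≤-trans 0≤ε+t (ℚ.≮⇒≥ ¬h)) 0≤ε+t (ℚ.≮⇒≥ ¬h) (ℚ.≮⇒≥ ¬h)
  u²≤ : (t ℚ.+ w) ℚ.* (t ℚ.+ w) ℚ.≤ (t ℚ.+ h) ℚ.* (t ℚ.+ h)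
  u²≤ = *-mono-≤ 0≤t+h 0≤t+w (ℚ.+-monoʳ-≤ t w≤) (ℚ.+-monoʳ-≤ t w≤)
  0≤2h[t+h] : 0ℚ ℚ.≤ ε ℚ.* (t ℚ.+ h)
  0≤2h[t+h] = subst (ℚ._≤ ε ℚ.* (t ℚ.+ h)) (ℚ.*-zeroʳ ε) (*-monoʳ-≤ (ℚ.<⇒≤ 0<ε) 0≤t+h)
  bound : h ℚ.* h ℚ.+ q ℚ.< (ε ℚ.+ t) ℚ.* (ε ℚ.+ t)
  bound = ℚ.<-≤-trans (ℚ.+-monoʳ-< (h ℚ.* h) (ℚ.<-≤-trans q<u² u²≤))
    (subst₂ ℚ._≤_ (ℚ.+-identityʳ (h ℚ.* h ℚ.+ (t ℚ.+ h) ℚ.* (t ℚ.+ h)))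
      (solve 2 (λ e t → con ½ :* e :* (con ½ :* e) :+ (t :+ con ½ :* e) :* (t :+ con ½ :* e) :+ e :* (t :+ con ½ :* e)
                        := (e :+ t) :* (e :+ t)) refl ε t)
      (ℚ.+-monoʳ-≤ (h ℚ.* h ℚ.+ (t ℚ.+ h) ℚ.* (t ℚ.+ h)) 0≤2h[t+h]))

-- Truncating at 0 makes √ total: √ x ≈ 0 for x ≤ 0, and √-square below
-- gives the defining property for 0 ≤ x.

√-seq : (ℕ → ℚ) → ℕ → ℚ
√-seq f n = lower (f n ℚ.⊔ 0ℚ) n

√-cauchy : ∀ x → Cauchy (√-seq (seq x))
√-cauchy x ε 0<ε =
  let h   = ½ ℚ.* ε
      0<h = pos*pos 0<½ 0<ε
      0<δ = pos*pos 0<h 0<h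
      (M , hM) = cauchy x (h ℚ.* h) 0<δ
      (B , 0<B , K , hK) = eventually-bounded x
      (N , hN) = width-→0 B h 0<h
      small : ∀ n → K ℕ.≤ n → N ℕ.≤ n → width (seq x n ℚ.⊔ 0ℚ) n ℚ.≤ h
      small n K≤n N≤n = ℚ.≤-trans
        (width-mono (ℚ.⊔-lub (ℚ.≤-trans (p≤∣p∣ (seq x n)) (ℚ.<⇒≤ (hK n K≤n))) (ℚ.<⇒≤ 0<B)) n) (hN n N≤n)
      step : ∀ m n → M ℕ.≤ m → M ℕ.≤ n → K ℕ.≤ n → N ℕ.≤ n → √-seq (seq x) m ℚ.< ε ℚ.+ √-seq (seq x) n
      step m n M≤m M≤n K≤n N≤n = √-step 0<ε (0≤lower (0≤p⊔0 (seq x n)) n) (ℚ.<⇒≤ (0<width (0≤p⊔0 (seq x n)) n))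
        (lower²≤ (0≤p⊔0 (seq x m)) m) (<upper² (0≤p⊔0 (seq x n)) n) (small n K≤n N≤n)
        (⊔0-<-+ (seq x m) (seq x n) 0<δ (∣p-q∣<r⇒p<r+q {seq x m} {seq x n} (hM m n M≤m M≤n)))
  in M ℕ.⊔ (K ℕ.⊔ N) , λ m n p q →
    let M≤m = ℕ.m⊔n≤o⇒m≤o M (K ℕ.⊔ N) p
        M≤n = ℕ.m⊔n≤o⇒m≤o M (K ℕ.⊔ N) q
        KN≤m = ℕ.m⊔n≤o⇒n≤o M (K ℕ.⊔ N) p
        KN≤n = ℕ.m⊔n≤o⇒n≤o M (K ℕ.⊔ N) q
    in ∣p-q∣<r (step m n M≤m M≤n (ℕ.m⊔n≤o⇒m≤o K N KN≤n) (ℕ.m⊔n≤o⇒n≤o K N KN≤n))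
               (step n m M≤n M≤m (ℕ.m⊔n≤o⇒m≤o K N KN≤m) (ℕ.m⊔n≤o⇒n≤o K N KN≤m))

infix 9 √_

√_ : ℝ → ℝ
seq    (√ x) = √-seq (seq x)
cauchy (√ x) = √-cauchy x

0≤√ : ∀ x → 0ℝ ≤ √ x
0≤√ x ε 0<ε = 0 , λ n _ → subst (ℚ._< ε ℚ.+ seq (√ x) n) (ℚ.+-identityʳ 0ℚ)
  (ℚ.+-mono-<-≤ 0<ε (0≤lower (0≤p⊔0 (seq x n)) n))

sq-close : ∀ s w q δ B → 0ℚ ℚ.≤ s → 0ℚ ℚ.≤ w → w ℚ.≤ δ → w ℚ.≤ 1ℚ → s ℚ.≤ B → q ℚ.< (s ℚ.+ w) ℚ.* (s ℚ.+ w) →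
  q ℚ.< (1ℚ ℚ.+ (B ℚ.+ B)) ℚ.* δ ℚ.+ s ℚ.* s
sq-close s w q δ B 0≤s 0≤w w≤δ w≤1 s≤B q< = ℚ.<-≤-trans q<
  (subst (ℚ._≤ (1ℚ ℚ.+ (B ℚ.+ B)) ℚ.* δ ℚ.+ s ℚ.* s)
    (solve 2 (λ s w → (w :+ (s :+ s)) :* w :+ s :* s := (s :+ w) :* (s :+ w)) refl s w)
    (ℚ.+-monoˡ-≤ (s ℚ.* s) (*-mono-≤ 0≤ 0≤w (ℚ.+-mono-≤ w≤1 (ℚ.+-mono-≤ s≤B s≤B)) w≤δ)))
  where
  0≤ : 0ℚ ℚ.≤ 1ℚ ℚ.+ (B ℚ.+ B)
  0≤ = ℚ.<⇒≤ (0<1+ (ℚ.+-mono-≤ (ℚ.≤-trans 0≤s s≤B) (ℚ.≤-trans 0≤s s≤B)))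

p⊔0< : ∀ p ε → 0ℚ ℚ.< ε → 0ℚ ℚ.< ε ℚ.+ p → p ℚ.⊔ 0ℚ ℚ.< ε ℚ.+ p
p⊔0< p ε 0<ε h with ℚ.⊔-sel p 0ℚ
... | inj₁ e rewrite e = subst (ℚ._< ε ℚ.+ p) (ℚ.+-identityˡ p) (ℚ.+-monoˡ-< p 0<ε)
... | inj₂ e rewrite e = h

√-square : ∀ x → 0ℝ ≤ x → √ x * √ x ≈ x
√-square x 0≤x ε 0<ε =
  let h = ½ ℚ.* ε
      0<h = pos*pos 0<½ 0<ε
      (B , 0<B , K , hK) = eventually-bounded (√ x)
      (C , 0<C , K′ , hK′) = eventually-bounded x
      0<D = 0<1+ (ℚ.+-mono-≤ (ℚ.<⇒≤ 0<B) (ℚ.<⇒≤ 0<B))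
      (δ , 0<δ , Dδ≡h) = divide 0<D 0<h
      (N , hN) = width-→0 C δ 0<δ
      (N′ , hN′) = width-→0 C 1ℚ 0<1
      (M , hM) = 0≤x h 0<h
  in (K ℕ.+ K′ ℕ.+ N ℕ.+ N′ ℕ.+ M) , λ n p →
    let s = seq (√ x) n
        q = seq x n ℚ.⊔ 0ℚ
        p4 = ℕ.m+n≤o⇒m≤o (K ℕ.+ K′ ℕ.+ N ℕ.+ N′) p
        p3 = ℕ.m+n≤o⇒m≤o (K ℕ.+ K′ ℕ.+ N) p4
        p2 = ℕ.m+n≤o⇒m≤o (K ℕ.+ K′) p3
        q≤C = ℚ.⊔-lub (ℚ.≤-trans (p≤∣p∣ (seq x n)) (ℚ.<⇒≤ (hK′ n (ℕ.m+n≤o⇒n≤o K p2)))) (ℚ.<⇒≤ 0<C)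
        w≤ = width-mono q≤C n
        0≤q = 0≤p⊔0 (seq x n)
        q<h+x : q ℚ.< h ℚ.+ seq x n
        q<h+x = p⊔0< (seq x n) h 0<h (hM n (ℕ.m+n≤o⇒n≤o (K ℕ.+ K′ ℕ.+ N ℕ.+ N′) p))
        x<h+s² : q ℚ.< h ℚ.+ s ℚ.* s
        x<h+s² = subst (λ z → q ℚ.< z ℚ.+ s ℚ.* s) Dδ≡h (sq-close s (width q n) q δ B (0≤lower 0≤q n) (ℚ.<⇒≤ (0<width 0≤q n))
          (ℚ.≤-trans w≤ (hN n (ℕ.m+n≤o⇒n≤o (K ℕ.+ K′) p3))) (ℚ.≤-trans w≤ (hN′ n (ℕ.m+n≤o⇒n≤o (K ℕ.+ K′ ℕ.+ N) p4)))
          (ℚ.≤-trans (p≤∣p∣ s) (ℚ.<⇒≤ (hK n (ℕ.m+n≤o⇒m≤o K p2)))) (<upper² 0≤q n))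
        h≤ε : h ℚ.≤ ε
        h≤ε = subst₂ ℚ._≤_ (ℚ.+-identityʳ h) (½+½ ε) (ℚ.+-monoʳ-≤ h (ℚ.<⇒≤ 0<h))
    in ∣p-q∣<r (ℚ.<-≤-trans (ℚ.≤-<-trans (lower²≤ 0≤q n) q<h+x) (ℚ.+-monoˡ-≤ (seq x n) h≤ε))
         (ℚ.<-≤-trans (ℚ.≤-<-trans (ℚ.p≤p⊔q (seq x n) 0ℚ) x<h+s²) (ℚ.+-monoˡ-≤ (s ℚ.* s) h≤ε))

record IsSupremum {I : Set} (f : I → ℝ) (s : ℝ) : Set where
  field
    upperBound : ∀ i → f i ≤ s
    least      : ∀ u → (∀ i → f i ≤ u) → s ≤ u

Point : Set
Point = ℝ × ℝ

d : Point → Point → ℝ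
d (x₁ , y₁) (x₂ , y₂) = √ ((x₁ - x₂) * (x₁ - x₂) + (y₁ - y₂) * (y₁ - y₂))

OnCircle : Point → Set
OnCircle (x , y) = x * x + y * y ≈ 1ℝ

𝒞 : Set
𝒞 = Σ Point OnCircle

R : Point
R = 1ℝ , 0ℝ

-- Every permutation of Fin (suc k) is, up to pointwise equality,
-- insert zero j π for exactly one j and one permutation π of Fin k.
permutations : ∀ k → List⁺ (Permutation′ k)
permutations zero    = [ id ]
permutations (suc k) =
  concatMap (λ j → List⁺.map (insert zero j) (permutations k)) (zero ∷ List.map suc (allFin k))

∑ : ∀ {n} → (Fin n → ℝ) → ℝ
∑ {zero}  f = 0ℝ
∑ {suc n} f = f zero + ∑ (λ i → f (suc i))

module _ {n : ℕ} (T : Fin (suc n) → 𝒞) where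

  pathLength : Permutation′ (suc n) → ℝ
  pathLength σ = d R (P zero) + ∑ {n} (λ i → d (P (inject₁ i)) (P (suc i)))
    where
    P : Fin (suc n) → Point
    P i = proj₁ (T (σ ⟨$⟩ʳ i))

  shortestPath : ℝ
  shortestPath = foldr₁ _⊓_ (List⁺.map pathLength (permutations (suc n)))

-- c[ k ]≈ s states that the supremum c_k exists and equals s.
c[_]≈_ : (k : ℕ) .{{_ : NonZero k}} → ℝ → Set
c[ suc n ]≈ s = IsSupremum (shortestPath {n}) s

{-# OPTIONS --safe #-}

-- Let a, p be the distances of T₁ from R and -R, let b, q be those of T₂, and
-- let e = d(T₁, T₂).  The minimum of the two paths is at most their mean
-- (a + b)/2 + e, and Ptolemy's inequality for R, T₁, -R, T₂ gives
-- 2e ≤ aq + bp.  Since a² + p² = b² + q² = 4, the maximum of a + b + aq + bp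
-- is attained at a = b = 2S, p = q = 2c, where S and c are the sine and cosine
-- of an angle with 4c² + c = 2: the defect from it is a combination of squares
-- with positive coefficients 1/(4S) and 1/(2Sc).  The pair of points
-- (cos, ± sin) of the double angle attains the bound.

module Submission where

open import Data.Nat.Base using (nonZero)
open import Defs
open import Data.Fin using (Fin; zero; suc)
open import Data.Integer using (+_)
import Data.Nat as ℕ
import Data.Nat.Properties as ℕ
open import Data.Product using (_,_; proj₁; proj₂)
open import Data.Rational as ℚ using (0ℚ; 1ℚ; ½; ∣_∣)
import Data.Rational.Properties as ℚ
open import Data.Rational.Solver using (module +-*-Solver)
open import Data.Sum using (inj₁; inj₂)
open import Relation.Binary.Bundles using (Preorder)
open import Relation.Binary.PropositionalEquality using (_≡_; refl; sym; trans; cong; subst; subst₂)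
import Relation.Binary.Reasoning.Preorder as PreorderReasoning
open import Relation.Nullary using (yes; no)
open import Relation.Nullary.Negation using (contradiction)

open +-*-Solver using (solve; _:+_; _:*_; _:-_; :-_; _:=_; con)

-- Signs and squares of rationals.

0≤+ : ∀ {p q} → 0ℚ ℚ.≤ p → 0ℚ ℚ.≤ q → 0ℚ ℚ.≤ p ℚ.+ q
0≤+ = ℚ.+-mono-≤

0≤* : ∀ {p q} → 0ℚ ℚ.≤ p → 0ℚ ℚ.≤ q → 0ℚ ℚ.≤ p ℚ.* q
0≤* {p} {q} 0≤p 0≤q = subst (ℚ._≤ p ℚ.* q) (ℚ.*-zeroʳ p) (*-monoʳ-≤ 0≤p 0≤q)

0≤p*p : ∀ p → 0ℚ ℚ.≤ p ℚ.* p
0≤p*p p with ℚ.≤-total 0ℚ p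
... | inj₁ 0≤p = 0≤* 0≤p 0≤p
... | inj₂ p≤0 = subst (0ℚ ℚ.≤_) (solve 1 (λ p → :- p :* :- p := p :* p) refl p)
                   (0≤* (ℚ.neg-antimono-≤ p≤0) (ℚ.neg-antimono-≤ p≤0))

square-cancel-< : ∀ {p q} → 0ℚ ℚ.≤ q → p ℚ.* p ℚ.< q ℚ.* q → p ℚ.< q
square-cancel-< {p} {q} 0≤q p²<q² with p ℚ.<? q
... | yes p<q = p<q
... | no  p≮q = contradiction (ℚ.<-≤-trans p²<q² (*-mono-≤ (ℚ.≤-trans 0≤q q≤p) 0≤q q≤p q≤p)) (ℚ.<-irrefl refl)
  where q≤p = ℚ.≮⇒≥ p≮q

-- Equality and order of the reals.

-- _≈_ and _≤_ unfold to statements about sequences, from which Agda cannot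
-- recover the reals; these record copies keep the two sides inferable.

infix 4 _≃_ _≼_

record _≃_ (x y : ℝ) : Set where
  constructor mk≃
  field ≃⇒≈ : x ≈ y

record _≼_ (x y : ℝ) : Set where
  constructor mk≼
  field ≼⇒≤ : x ≤ y

open _≃_
open _≼_

-- The real operations act index by index, so this lets the rational ring solver prove identities
-- between reals.
pointwise-≃ : ∀ {x y} → (∀ n → seq x n ≡ seq y n) → x ≃ y
pointwise-≃ {x} {y} h = mk≃ λ ε 0<ε → 0 , λ n _ → subst (ℚ._< ε)
  (sym (cong ∣_∣ (trans (cong (ℚ._- seq y n) (h n)) (ℚ.+-inverseʳ (seq y n))))) 0<ε

≃-refl : ∀ {x} → x ≃ x
≃-refl = pointwise-≃ λ _ → refl

≃-sym : ∀ {x y} → x ≃ y → y ≃ x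
≃-sym {x} {y} (mk≃ h) = mk≃ λ ε 0<ε → let (N , hN) = h ε 0<ε in
  N , λ n N≤n → subst (ℚ._< ε) (∣p-q∣≡∣q-p∣ (seq x n) (seq y n)) (hN n N≤n)

pointwise-≼ : ∀ {x y} → (∀ n → seq x n ℚ.≤ seq y n) → x ≼ y
pointwise-≼ {x} {y} h = mk≼ λ ε 0<ε → 0 , λ n _ →
  subst (ℚ._< ε ℚ.+ seq y n) (ℚ.+-identityˡ (seq x n)) (ℚ.+-mono-<-≤ 0<ε (h n))

≃⇒≼ : ∀ {x y} → x ≃ y → x ≼ y
≃⇒≼ {x} {y} (mk≃ h) = mk≼ λ ε 0<ε → let (N , hN) = h ε 0<ε in
  N , λ n N≤n → ∣p-q∣<r⇒p<r+q {seq x n} {seq y n} (hN n N≤n)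

≼-antisym : ∀ {x y} → x ≼ y → y ≼ x → x ≃ y
≼-antisym (mk≼ h) (mk≼ k) = mk≃ λ ε 0<ε →
  let (M , hM) = h ε 0<ε
      (N , hN) = k ε 0<ε
  in M ℕ.⊔ N , λ n p → ∣p-q∣<r (hM n (ℕ.m⊔n≤o⇒m≤o M N p)) (hN n (ℕ.m⊔n≤o⇒n≤o M N p))

+-mono-≼ : ∀ {x y u v} → x ≼ y → u ≼ v → x + u ≼ y + v
+-mono-≼ {x} {y} {u} {v} (mk≼ h) (mk≼ k) = mk≼ λ ε 0<ε →
  let 0<δ = pos*pos 0<½ 0<ε
      (M , hM) = h (½ ℚ.* ε) 0<δ
      (N , hN) = k (½ ℚ.* ε) 0<δ
  in M ℕ.⊔ N , λ n p → subst (seq x n ℚ.+ seq u n ℚ.<_)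
       (solve 3 (λ e y v → (con ½ :* e :+ y) :+ (con ½ :* e :+ v) := e :+ (y :+ v)) refl ε (seq y n) (seq v n))
       (ℚ.+-mono-< (hM n (ℕ.m⊔n≤o⇒m≤o M N p)) (hN n (ℕ.m⊔n≤o⇒n≤o M N p)))

≼-trans : ∀ {x y z} → x ≼ y → y ≼ z → x ≼ z
≼-trans {x} {y} {z} (mk≼ h) (mk≼ k) = mk≼ λ ε 0<ε →
  let 0<δ = pos*pos 0<½ 0<ε
      (M , hM) = h (½ ℚ.* ε) 0<δ
      (N , hN) = k (½ ℚ.* ε) 0<δ
  in M ℕ.⊔ N , λ n p → subst (seq x n ℚ.<_)
       (solve 2 (λ e z → con ½ :* e :+ (con ½ :* e :+ z) := e :+ z) refl ε (seq z n))
       (ℚ.<-trans (hM n (ℕ.m⊔n≤o⇒m≤o M N p)) (ℚ.+-monoʳ-< (½ ℚ.* ε) (hN n (ℕ.m⊔n≤o⇒n≤o M N p))))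

≃-trans : ∀ {x y z} → x ≃ y → y ≃ z → x ≃ z
≃-trans h k = ≼-antisym (≼-trans (≃⇒≼ h) (≃⇒≼ k)) (≼-trans (≃⇒≼ (≃-sym k)) (≃⇒≼ (≃-sym h)))

≼-preorder : Preorder _ _ _
≼-preorder = record
  { _≈_ = _≃_
  ; _≲_ = _≼_
  ; isPreorder = record
    { isEquivalence = record { refl = ≃-refl ; sym = ≃-sym ; trans = ≃-trans }
    ; reflexive     = ≃⇒≼
    ; trans         = ≼-trans
    }
  }

open PreorderReasoning ≼-preorder

+-cong : ∀ {x y u v} → x ≃ y → u ≃ v → x + u ≃ y + v
+-cong h k = ≼-antisym (+-mono-≼ (≃⇒≼ h) (≃⇒≼ k)) (+-mono-≼ (≃⇒≼ (≃-sym h)) (≃⇒≼ (≃-sym k)))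

*-congˡ : ∀ z {x y} → x ≃ y → z * x ≃ z * y
*-congˡ z {x} {y} (mk≃ h) = mk≃ λ ε 0<ε →
  let (B , 0<B , K , hK) = eventually-bounded z
      (δ , 0<δ , Bδ≡ε) = divide 0<B 0<ε
      (N , hN) = h δ 0<δ
  in K ℕ.⊔ N , λ n p → subst₂ ℚ._<_
       (trans (sym (ℚ.∣p*q∣≡∣p∣*∣q∣ (seq z n) (seq x n ℚ.- seq y n)))
         (cong ∣_∣ (solve 3 (λ z x y → z :* (x :- y) := z :* x :- z :* y) refl (seq z n) (seq x n) (seq y n))))
       Bδ≡ε
       (*-mono-< 0<B (ℚ.0≤∣p∣ (seq x n ℚ.- seq y n)) (hK n (ℕ.m⊔n≤o⇒m≤o K N p)) (hN n (ℕ.m⊔n≤o⇒n≤o K N p)))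

*-cong : ∀ {x y u v} → x ≃ y → u ≃ v → x * u ≃ y * v
*-cong {x} {y} {u} {v} h k = begin-equality
  x * u ≈⟨ *-congˡ x k ⟩
  x * v ≈⟨ pointwise-≃ (λ n → ℚ.*-comm (seq x n) (seq v n)) ⟩
  v * x ≈⟨ *-congˡ v h ⟩
  v * y ≈⟨ pointwise-≃ (λ n → ℚ.*-comm (seq v n) (seq y n)) ⟩
  y * v ∎

-- Serves to compute modulo a relation `u ≃ v`: the ring solver proves an identity that carries the
-- relation with an explicit cofactor `k`, and this lemma removes or inserts that term.
+-*-cancel : ∀ {u v} → u ≃ v → ∀ x k → x + k * (u - v) ≃ x
+-*-cancel {u} {v} h x k = begin-equality
  x + k * (u - v) ≈⟨ +-cong (≃-refl {x}) (*-congˡ k (+-cong h (≃-refl { - v }))) ⟩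
  x + k * (v - v) ≈⟨ pointwise-≃ (λ n → solve 3 (λ x k v → x :+ k :* (v :- v) := x) refl (seq x n) (seq k n) (seq v n)) ⟩
  x               ∎

-- The hypothesis is taken at tolerance ε², because ε² + y² ≤ (ε + y)² for y ≥ 0. Nonnegativity at
-- every index is available for sums and products of distances, since the bisection for `√_` never
-- goes below 0. The sign of `x` is free.
square-cancel-≼ : ∀ {x y} → (∀ n → 0ℚ ℚ.≤ seq y n) → x * x ≼ y * y → x ≼ y
square-cancel-≼ {x} {y} 0≤y (mk≼ h) = mk≼ λ ε 0<ε →
  let (N , hN) = h (ε ℚ.* ε) (pos*pos 0<ε 0<ε)
      0≤ε = ℚ.<⇒≤ 0<ε
  in N , λ n N≤n → square-cancel-< (0≤+ 0≤ε (0≤y n)) (ℚ.<-≤-trans (hN n N≤n)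
       (subst₂ ℚ._≤_ (ℚ.+-identityʳ _)
         (solve 2 (λ e y → e :* e :+ y :* y :+ (e :* y :+ e :* y) := (e :+ y) :* (e :+ y)) refl ε (seq y n))
         (ℚ.+-monoʳ-≤ (ε ℚ.* ε ℚ.+ seq y n ℚ.* seq y n) (0≤+ (0≤* 0≤ε (0≤y n)) (0≤* 0≤ε (0≤y n))))))

double-cancel-≼ : ∀ {x y} → x + x ≼ y + y → x ≼ y
double-cancel-≼ {x} {y} (mk≼ h) = mk≼ λ ε 0<ε →
  let (N , hN) = h (ε ℚ.+ ε) (ℚ.+-mono-< 0<ε 0<ε)
  in N , λ n N≤n → subst₂ ℚ._<_
       (solve 1 (λ x → con ½ :* (x :+ x) := x) refl (seq x n))
       (solve 2 (λ e y → con ½ :* ((e :+ e) :+ (y :+ y)) := e :+ y) refl ε (seq y n))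
       (ℚ.*-monoʳ-<-pos ½ (hN n N≤n))

x⊓y≼x : ∀ x y → x ⊓ y ≼ x
x⊓y≼x x y = pointwise-≼ λ n → ℚ.p⊓q≤p (seq x n) (seq y n)

x⊓y≼y : ∀ x y → x ⊓ y ≼ y
x⊓y≼y x y = pointwise-≼ λ n → ℚ.p⊓q≤q (seq x n) (seq y n)

⊓-glb-≼ : ∀ {x y z} → z ≼ x → z ≼ y → z ≼ x ⊓ y
⊓-glb-≼ {x} {y} {z} (mk≼ h) (mk≼ k) = mk≼ λ ε 0<ε →
  let (M , hM) = h ε 0<ε
      (N , hN) = k ε 0<ε
  in M ℕ.⊔ N , λ n p → subst (ℚ._< ε ℚ.+ seq (x ⊓ y) n) (ℚ.⊓-idem (seq z n))
       (⊓-<-+ (seq z n) (seq z n) (seq x n) (seq y n) ε (hM n (ℕ.m⊔n≤o⇒m≤o M N p)) (hN n (ℕ.m⊔n≤o⇒n≤o M N p)))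

0≤√-seq : ∀ x n → 0ℚ ℚ.≤ seq (√ x) n
0≤√-seq x n = 0≤lower (0≤p⊔0 (seq x n)) n

√-square-≃ : ∀ {x} → (∀ n → 0ℚ ℚ.≤ seq x n) → √ x * √ x ≃ x
√-square-≃ {x} 0≤x = mk≃ (√-square x (≼⇒≤ (pointwise-≼ {0ℝ} {x} 0≤x)))

-- Chords of the unit circle and Ptolemy's inequality.

2ℝ 4ℝ 8ℝ : ℝ
2ℝ = fromℕ 2
4ℝ = fromℕ 4
8ℝ = fromℕ 8

:1 :2 :4 :8 : ∀ {n} → +-*-Solver.Polynomial n
:1 = con 1ℚ
:2 = con (+ 2 ℚ./ 1)
:4 = con (+ 4 ℚ./ 1)
:8 = con (+ 8 ℚ./ 1)

-R : Point
-R = - 1ℝ , 0ℝ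

0≤d : ∀ P Q n → 0ℚ ℚ.≤ seq (d P Q) n
0≤d (x , y) (x′ , y′) = 0≤√-seq ((x - x′) * (x - x′) + (y - y′) * (y - y′))

d-square : ∀ x y x′ y′ → d (x , y) (x′ , y′) * d (x , y) (x′ , y′) ≃ (x - x′) * (x - x′) + (y - y′) * (y - y′)
d-square x y x′ y′ = √-square-≃ λ n → 0≤+ (0≤p*p (seq (x - x′) n)) (0≤p*p (seq (y - y′) n))

≼-d : ∀ {z} x y x′ y′ → z * z ≃ (x - x′) * (x - x′) + (y - y′) * (y - y′) → z ≼ d (x , y) (x′ , y′)
≼-d x y x′ y′ h = square-cancel-≼ (0≤d (x , y) (x′ , y′)) (≃⇒≼ (≃-trans h (≃-sym (d-square x y x′ y′))))

-- The `n`-th term of a square root depends only on the `n`-th term of the radicand, so equal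
-- radicands give equal terms.
d-sym : ∀ P Q → d P Q ≃ d Q P
d-sym (x , y) (x′ , y′) = pointwise-≃ λ n → cong (λ z → lower (z ℚ.⊔ 0ℚ) n)
  (solve 4 (λ x y x′ y′ → (x :- x′) :* (x :- x′) :+ (y :- y′) :* (y :- y′)
                       := (x′ :- x) :* (x′ :- x) :+ (y′ :- y) :* (y′ :- y))
    refl (seq x n) (seq y n) (seq x′ n) (seq y′ n))

d-R-square : ∀ x y → OnCircle (x , y) → d R (x , y) * d R (x , y) ≃ 2ℝ - 2ℝ * x
d-R-square x y h = begin-equality
  d R (x , y) * d R (x , y)                  ≈⟨ d-square 1ℝ 0ℝ x y ⟩
  (1ℝ - x) * (1ℝ - x) + (0ℝ - y) * (0ℝ - y)  ≈⟨ pointwise-≃ (λ n → solve 2 (λ x y →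
    (:1 :- x) :* (:1 :- x) :+ (con 0ℚ :- y) :* (con 0ℚ :- y)
    := (:2 :- :2 :* x) :+ :1 :* (x :* x :+ y :* y :- :1)) refl (seq x n) (seq y n)) ⟩
  2ℝ - 2ℝ * x + 1ℝ * (x * x + y * y - 1ℝ)    ≈⟨ +-*-cancel (mk≃ h) (2ℝ - 2ℝ * x) 1ℝ ⟩
  2ℝ - 2ℝ * x                                ∎

d--R-square : ∀ x y → OnCircle (x , y) → d -R (x , y) * d -R (x , y) ≃ 2ℝ + 2ℝ * x
d--R-square x y h = begin-equality
  d -R (x , y) * d -R (x , y)                    ≈⟨ d-square (- 1ℝ) 0ℝ x y ⟩
  (- 1ℝ - x) * (- 1ℝ - x) + (0ℝ - y) * (0ℝ - y)  ≈⟨ pointwise-≃ (λ n → solve 2 (λ x y →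
    (:- :1 :- x) :* (:- :1 :- x) :+ (con 0ℚ :- y) :* (con 0ℚ :- y)
    := (:2 :+ :2 :* x) :+ :1 :* (x :* x :+ y :* y :- :1)) refl (seq x n) (seq y n)) ⟩
  2ℝ + 2ℝ * x + 1ℝ * (x * x + y * y - 1ℝ)        ≈⟨ +-*-cancel (mk≃ h) (2ℝ + 2ℝ * x) 1ℝ ⟩
  2ℝ + 2ℝ * x                                    ∎

-- Both sides are the square of twice the area of the right triangle -R, R, (x , y).
chord-product : ∀ x y → OnCircle (x , y) →
  let ap = d R (x , y) * d -R (x , y) in ap * ap ≃ 4ℝ * (y * y)
chord-product x y h = begin-equality
  (a * p) * (a * p)                                   ≈⟨ pointwise-≃ (λ n → solve 2 (λ a p → (a :* p) :* (a :* p) := (a :* a) :* (p :* p)) refl (seq a n) (seq p n)) ⟩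
  (a * a) * (p * p)                                   ≈⟨ *-cong (d-R-square x y h) (d--R-square x y h) ⟩
  (2ℝ - 2ℝ * x) * (2ℝ + 2ℝ * x)                       ≈⟨ pointwise-≃ (λ n → solve 2 (λ x y →
    (:2 :- :2 :* x) :* (:2 :+ :2 :* x) := :4 :* (y :* y) :+ :- :4 :* (x :* x :+ y :* y :- :1)) refl (seq x n) (seq y n)) ⟩
  4ℝ * (y * y) + - 4ℝ * (x * x + y * y - 1ℝ)          ≈⟨ +-*-cancel (mk≃ h) (4ℝ * (y * y)) (- 4ℝ) ⟩
  4ℝ * (y * y)                                        ∎
  where
  a = d R (x , y)
  p = d -R (x , y)

-- On the circle 4e² = 8 - 8xx′ - 8yy′, while a²q² + b²p² = 8 - 8xx′. After squaring, what remains
-- is -4yy′ ≤ (ap)(bq), taken twice.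
ptolemy : ∀ x y x′ y′ → OnCircle (x , y) → OnCircle (x′ , y′) →
  let e = d (x , y) (x′ , y′) in
  e + e ≼ d R (x , y) * d -R (x′ , y′) + d R (x′ , y′) * d -R (x , y)
ptolemy x y x′ y′ h h′ = square-cancel-≼
  (λ n → 0≤+ (0≤* (0≤d R T n) (0≤d -R T′ n)) (0≤* (0≤d R T′ n) (0≤d -R T n)))
  (begin
    (e + e) * (e + e)
      ≈⟨ pointwise-≃ (λ n → solve 1 (λ e → (e :+ e) :* (e :+ e) := :4 :* (e :* e)) refl (seq e n)) ⟩
    4ℝ * (e * e)
      ≈⟨ *-congˡ 4ℝ (d-square x y x′ y′) ⟩
    4ℝ * ((x - x′) * (x - x′) + (y - y′) * (y - y′))
      ≈⟨ pointwise-≃ (λ n → solve 4 (λ x y x′ y′ →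
           :4 :* ((x :- x′) :* (x :- x′) :+ (y :- y′) :* (y :- y′))
           := (:8 :- :8 :* (x :* x′)) :+ (:- (:4 :* (y :* y′)) :+ :- (:4 :* (y :* y′)))
              :+ :4 :* (x :* x :+ y :* y :- :1) :+ :4 :* (x′ :* x′ :+ y′ :* y′ :- :1))
           refl (seq x n) (seq y n) (seq x′ n) (seq y′ n)) ⟩
    z + (w + w) + 4ℝ * (x * x + y * y - 1ℝ) + 4ℝ * (x′ * x′ + y′ * y′ - 1ℝ)
      ≈⟨ +-*-cancel (mk≃ h′) (z + (w + w) + 4ℝ * (x * x + y * y - 1ℝ)) 4ℝ ⟩
    z + (w + w) + 4ℝ * (x * x + y * y - 1ℝ)
      ≈⟨ +-*-cancel (mk≃ h) (z + (w + w)) 4ℝ ⟩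
    z + (w + w)
      ≲⟨ +-mono-≼ (≃⇒≼ (≃-refl {z})) (+-mono-≼ w≼ w≼) ⟩
    z + (a * p * (b * q) + a * p * (b * q))
      ≈⟨ pointwise-≃ (λ n → solve 3 (λ x x′ v →
           (:8 :- :8 :* (x :* x′)) :+ (v :+ v)
           := (:2 :- :2 :* x) :* (:2 :+ :2 :* x′) :+ (:2 :- :2 :* x′) :* (:2 :+ :2 :* x) :+ (v :+ v))
           refl (seq x n) (seq x′ n) (seq (a * p * (b * q)) n)) ⟩
    (2ℝ - 2ℝ * x) * (2ℝ + 2ℝ * x′) + (2ℝ - 2ℝ * x′) * (2ℝ + 2ℝ * x) + (a * p * (b * q) + a * p * (b * q))
      ≈⟨ +-cong (+-cong (*-cong (d-R-square x y h) (d--R-square x′ y′ h′))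
                        (*-cong (d-R-square x′ y′ h′) (d--R-square x y h))) ≃-refl ⟨
    (a * a) * (q * q) + (b * b) * (p * p) + (a * p * (b * q) + a * p * (b * q))
      ≈⟨ pointwise-≃ (λ n → solve 4 (λ a b p q →
           (a :* a) :* (q :* q) :+ (b :* b) :* (p :* p) :+ (a :* p :* (b :* q) :+ a :* p :* (b :* q))
           := (a :* q :+ b :* p) :* (a :* q :+ b :* p)) refl (seq a n) (seq b n) (seq p n) (seq q n)) ⟩
    (a * q + b * p) * (a * q + b * p) ∎)
  where
  T T′ : Point
  T  = x , y
  T′ = x′ , y′
  a = d R T
  p = d -R T
  b = d R T′
  q = d -R T′
  e = d T T′
  z = 8ℝ - 8ℝ * (x * x′)
  w = - (4ℝ * (y * y′))
  w≼ : w ≼ a * p * (b * q)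
  -- Both sides have square 16y²y′², and the right side is nonnegative: this is -4yy′ ≤ 4|yy′|.
  w≼ = square-cancel-≼
    (λ n → 0≤* (0≤* (0≤d R T n) (0≤d -R T n)) (0≤* (0≤d R T′ n) (0≤d -R T′ n)))
    (≃⇒≼ (begin-equality
      w * w                                   ≈⟨ pointwise-≃ (λ n → solve 2 (λ y y′ →
        :- (:4 :* (y :* y′)) :* :- (:4 :* (y :* y′)) := :4 :* (y :* y) :* (:4 :* (y′ :* y′))) refl (seq y n) (seq y′ n)) ⟩
      4ℝ * (y * y) * (4ℝ * (y′ * y′))         ≈⟨ *-cong (chord-product x y h) (chord-product x′ y′ h′) ⟨
      a * p * (a * p) * (b * q * (b * q))     ≈⟨ pointwise-≃ (λ n → solve 2 (λ u v →
        u :* u :* (v :* v) := u :* v :* (u :* v)) refl (seq (a * p) n) (seq (b * q) n)) ⟩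
      a * p * (b * q) * (a * p * (b * q))     ∎))

-- The constants of the optimal configuration.

-- K and D are the inverses of S and c, written without division.

r t S K c D : ℝ
r = √ (fromℕ 33)
t = √ (fromℕ 30 + 2ℝ * r)
S = t / 8
K = t * (fromℕ 15 - r) / 48
c = (r - 1ℝ) / 8
D = (r + 1ℝ) / 4

optimum : ℝ
optimum = (r + fromℕ 3) / 16 * t

r²≃33 : r * r ≃ fromℕ 33
r²≃33 = √-square-≃ λ n → ℚ.≤ᵇ⇒≤ _

0≤r : ∀ n → 0ℚ ℚ.≤ seq r n
0≤r = 0≤√-seq (fromℕ 33)

0≤t : ∀ n → 0ℚ ℚ.≤ seq t n
0≤t = 0≤√-seq (fromℕ 30 + 2ℝ * r)

t²≃30+2r : t * t ≃ fromℕ 30 + 2ℝ * r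
t²≃30+2r = √-square-≃ λ n → 0≤+ {+ 30 ℚ./ 1} (ℚ.≤ᵇ⇒≤ _) (0≤* {+ 2 ℚ./ 1} (ℚ.≤ᵇ⇒≤ _) (0≤r n))

-- Makes the factor 15 - r of `K` nonnegative at every index: each approximant has square at most
-- 33, and 225 - 33 = 192.
r<15 : ∀ n → seq r n ℚ.< + 15 ℚ./ 1
r<15 n = square-cancel-< (ℚ.≤ᵇ⇒≤ _)
  (ℚ.≤-<-trans (lower²≤ (0≤p⊔0 (+ 33 ℚ./ 1)) n) (0<q-p⇒p<q (ℚ.positive⁻¹ (+ 192 ℚ./ 1))))

0≤K : ∀ n → 0ℚ ℚ.≤ seq K n
0≤K n = 0≤* (0≤* (0≤t n) 0≤15-r) (ℚ.≤ᵇ⇒≤ _)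
  where
  0≤15-r : 0ℚ ℚ.≤ (+ 15 ℚ./ 1) ℚ.- seq r n
  0≤15-r = subst (ℚ._≤ (+ 15 ℚ./ 1) ℚ.- seq r n) (ℚ.+-inverseʳ (seq r n))
    (ℚ.+-monoˡ-≤ (ℚ.- seq r n) (ℚ.<⇒≤ (r<15 n)))

0≤D : ∀ n → 0ℚ ℚ.≤ seq D n
0≤D n = 0≤* (0≤+ (0≤r n) (ℚ.<⇒≤ 0<1)) (ℚ.≤ᵇ⇒≤ _)

cD≃1 : c * D ≃ 1ℝ
cD≃1 = begin-equality
  c * D
    ≈⟨ pointwise-≃ (λ n → solve 1 (λ r → (r :- :1) :* con (+ 1 ℚ./ 8) :* ((r :+ :1) :* con (+ 1 ℚ./ 4))
         := :1 :+ con (+ 1 ℚ./ 32) :* (r :* r :- con (+ 33 ℚ./ 1))) refl (seq r n)) ⟩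
  1ℝ + fromℚ (+ 1 ℚ./ 32) * (r * r - fromℕ 33)
    ≈⟨ +-*-cancel r²≃33 1ℝ (fromℚ (+ 1 ℚ./ 32)) ⟩
  1ℝ ∎

-- Multiplied by `c`, and with `cD≃1`, this is the equation 4c² + c = 2 of the optimal angle.
1+4c≃2D : 1ℝ + 4ℝ * c ≃ 2ℝ * D
1+4c≃2D = pointwise-≃ λ n → solve 1 (λ r →
  :1 :+ :4 :* ((r :- :1) :* con (+ 1 ℚ./ 8)) := :2 :* ((r :+ :1) :* con (+ 1 ℚ./ 4))) refl (seq r n)

-- By r² = 33, (30 + 2r)(15 - r) = 450 - 2r² = 384 = 48 · 8.
KS≃1 : K * S ≃ 1ℝ
KS≃1 = begin-equality
  K * S
    ≈⟨ pointwise-≃ (λ n → solve 2 (λ r t →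
         t :* (con (+ 15 ℚ./ 1) :- r) :* con (+ 1 ℚ./ 48) :* (t :* con (+ 1 ℚ./ 8))
         := :1 :+ con (ℚ.- (+ 1 ℚ./ 192)) :* (r :* r :- con (+ 33 ℚ./ 1))
            :+ (con (+ 15 ℚ./ 1) :- r) :* con (+ 1 ℚ./ 384) :* (t :* t :- (con (+ 30 ℚ./ 1) :+ :2 :* r)))
         refl (seq r n) (seq t n)) ⟩
  1ℝ + k * (r * r - fromℕ 33) + (fromℕ 15 - r) / 384 * (t * t - (fromℕ 30 + 2ℝ * r))
    ≈⟨ +-*-cancel t²≃30+2r (1ℝ + k * (r * r - fromℕ 33)) ((fromℕ 15 - r) / 384) ⟩
  1ℝ + k * (r * r - fromℕ 33)
    ≈⟨ +-*-cancel r²≃33 1ℝ k ⟩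
  1ℝ ∎
  where k = fromℚ (ℚ.- (+ 1 ℚ./ 192))

S²+c²≃1 : S * S + c * c ≃ 1ℝ
S²+c²≃1 = begin-equality
  S * S + c * c
    ≈⟨ pointwise-≃ (λ n → solve 2 (λ r t →
         t :* con (+ 1 ℚ./ 8) :* (t :* con (+ 1 ℚ./ 8))
           :+ (r :- :1) :* con (+ 1 ℚ./ 8) :* ((r :- :1) :* con (+ 1 ℚ./ 8))
         := :1 :+ con (+ 1 ℚ./ 64) :* (r :* r :- con (+ 33 ℚ./ 1))
            :+ con (+ 1 ℚ./ 64) :* (t :* t :- (con (+ 30 ℚ./ 1) :+ :2 :* r)))
         refl (seq r n) (seq t n)) ⟩
  1ℝ + k * (r * r - fromℕ 33) + k * (t * t - (fromℕ 30 + 2ℝ * r))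
    ≈⟨ +-*-cancel t²≃30+2r (1ℝ + k * (r * r - fromℕ 33)) k ⟩
  1ℝ + k * (r * r - fromℕ 33)
    ≈⟨ +-*-cancel r²≃33 1ℝ k ⟩
  1ℝ ∎
  where k = fromℚ (+ 1 ℚ./ 64)

-- The length of one path at the optimum: a chord 2S from `R`, then a chord 4Sc between the two
-- points.
optimum≃2S+4Sc : optimum ≃ 2ℝ * S + 4ℝ * (S * c)
optimum≃2S+4Sc = pointwise-≃ λ n → solve 2 (λ r t →
  (r :+ con (+ 3 ℚ./ 1)) :* con (+ 1 ℚ./ 16) :* t
  := :2 :* (t :* con (+ 1 ℚ./ 8)) :+ :4 :* (t :* con (+ 1 ℚ./ 8) :* ((r :- :1) :* con (+ 1 ℚ./ 8))))
  refl (seq r n) (seq t n)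

-- The upper bound.

-- The squares come from AM-GM, 2aq ≤ (c/S)a² + (S/c)q², and from completing the
-- square in a; the kᵢ are the cofactors of the relations among a, …, q, S, K, c, D.
weighted-sum-≼ : ∀ {a b p q} → a * a + p * p ≃ 4ℝ → b * b + q * q ≃ 4ℝ →
  a + b + (a * q + b * p) ≼ optimum + optimum
weighted-sum-≼ {a} {b} {p} {q} ha hb = begin
  L
    ≲⟨ pointwise-≼ (λ n → subst (ℚ._≤ seq (L + squares) n) (ℚ.+-identityʳ (seq L n))
         (ℚ.+-monoʳ-≤ (seq L n) (0≤squares n))) ⟩
  L + squares
    -- From here on all steps are equalities; each inserts a vanishing multiple of one relation.
    ≈⟨ +-*-cancel KS≃1 (L + squares) k₁ ⟨
  E₁
    ≈⟨ +-*-cancel cD≃1 E₁ k₂ ⟨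
  E₂
    ≈⟨ +-*-cancel 1+4c≃2D E₂ k₃ ⟨
  E₃
    ≈⟨ +-*-cancel S²+c²≃1 E₃ k₄ ⟨
  E₄
    ≈⟨ +-*-cancel ha E₄ k₅ ⟨
  E₅
    ≈⟨ +-*-cancel hb E₅ k₅ ⟨
  E₅ + k₅ * (b * b + q * q - 4ℝ)
    -- With every relation inserted, the two sides agree as polynomials in eight independent
    -- variables.
    ≈⟨ pointwise-≃ (λ n → solve 8 (λ a b p q S K c D →
         let X  = a :* a :+ b :* b
             k₅ = :- (:½ :* (K :* D :* (S :* S)))
         in a :+ b :+ (a :* q :+ b :* p)
            :+ (:¼ :* K :* ((a :- :2 :* S) :* (a :- :2 :* S) :+ (b :- :2 :* S) :* (b :- :2 :* S))
                :+ :½ :* (K :* D) :* ((c :* a :- S :* q) :* (c :* a :- S :* q) :+ (c :* b :- S :* p) :* (c :* b :- S :* p)))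
            :+ (a :+ b :+ D :* c :* (a :* q :+ b :* p) :- :2 :* S :- :4 :* (D :* S)) :* (K :* S :- :1)
            :+ (a :* q :+ b :* p :- X :* (K :* c)) :* (c :* D :- :1)
            :+ (:2 :* S :- :¼ :* (X :* K)) :* (:1 :+ :4 :* c :- :2 :* D)
            :+ :½ :* (X :* (K :* D)) :* (S :* S :+ c :* c :- :1)
            :+ k₅ :* (a :* a :+ p :* p :- :4)
            :+ k₅ :* (b :* b :+ q :* q :- :4)
         := (:2 :* S :+ :4 :* (S :* c)) :+ (:2 :* S :+ :4 :* (S :* c)))
         refl (seq a n) (seq b n) (seq p n) (seq q n) (seq S n) (seq K n) (seq c n) (seq D n)) ⟩
  (2ℝ * S + 4ℝ * (S * c)) + (2ℝ * S + 4ℝ * (S * c))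
    ≈⟨ +-cong optimum≃2S+4Sc optimum≃2S+4Sc ⟨
  optimum + optimum ∎
  where
  ½ℝ = fromℚ ½
  ¼ℝ = fromℚ (+ 1 ℚ./ 4)
  :½ :¼ : ∀ {n} → +-*-Solver.Polynomial n
  :½ = con ½
  :¼ = con (+ 1 ℚ./ 4)
  L = a + b + (a * q + b * p)
  squares = ¼ℝ * K * ((a - 2ℝ * S) * (a - 2ℝ * S) + (b - 2ℝ * S) * (b - 2ℝ * S))
          + ½ℝ * (K * D) * ((c * a - S * q) * (c * a - S * q) + (c * b - S * p) * (c * b - S * p))
  0≤squares : ∀ n → 0ℚ ℚ.≤ seq squares n
  0≤squares n = 0≤+
    (0≤* (0≤* {+ 1 ℚ./ 4} (ℚ.≤ᵇ⇒≤ _) (0≤K n))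
         (0≤+ (0≤p*p (seq (a - 2ℝ * S) n)) (0≤p*p (seq (b - 2ℝ * S) n))))
    (0≤* (0≤* {½} (ℚ.<⇒≤ 0<½) (0≤* (0≤K n) (0≤D n)))
         (0≤+ (0≤p*p (seq (c * a - S * q) n)) (0≤p*p (seq (c * b - S * p) n))))
  X  = a * a + b * b
  k₁ = a + b + D * c * (a * q + b * p) - 2ℝ * S - 4ℝ * (D * S)
  k₂ = a * q + b * p - X * (K * c)
  k₃ = 2ℝ * S - ¼ℝ * (X * K)
  k₄ = ½ℝ * (X * (K * D))
  k₅ = - (½ℝ * (K * D * (S * S)))
  E₁ = L + squares + k₁ * (K * S - 1ℝ)
  E₂ = E₁ + k₂ * (c * D - 1ℝ)
  E₃ = E₂ + k₃ * (1ℝ + 4ℝ * c - 2ℝ * D)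
  E₄ = E₃ + k₄ * (S * S + c * c - 1ℝ)
  E₅ = E₄ + k₅ * (a * a + p * p - 4ℝ)

d-R²+d--R² : ∀ x y → OnCircle (x , y) → d R (x , y) * d R (x , y) + d -R (x , y) * d -R (x , y) ≃ 4ℝ
d-R²+d--R² x y h = begin-equality
  d R (x , y) * d R (x , y) + d -R (x , y) * d -R (x , y)  ≈⟨ +-cong (d-R-square x y h) (d--R-square x y h) ⟩
  (2ℝ - 2ℝ * x) + (2ℝ + 2ℝ * x)                            ≈⟨ pointwise-≃ (λ n → solve 1 (λ x →
    (:2 :- :2 :* x) :+ (:2 :+ :2 :* x) := :4) refl (seq x n)) ⟩
  4ℝ                                                       ∎

shortestPath-≼ : ∀ T → shortestPath {1} T ≼ optimum
shortestPath-≼ T = double-cancel-≼ (begin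
  shortestPath T + shortestPath T
    -- The minimum over the two permutations computes to `path₁ ⊓ path₂`.
    ≲⟨ +-mono-≼ (x⊓y≼x path₁ path₂) (x⊓y≼y path₁ path₂) ⟩
  path₁ + path₂
    ≈⟨ +-cong (≃-refl {path₁}) (+-cong (≃-refl {b}) (+-cong (d-sym P′ P) ≃-refl)) ⟩
  a + (e + 0ℝ) + (b + (e + 0ℝ))
    ≈⟨ pointwise-≃ (λ n → solve 3 (λ a b e →
         a :+ (e :+ con 0ℚ) :+ (b :+ (e :+ con 0ℚ)) := a :+ b :+ (e :+ e)) refl (seq a n) (seq b n) (seq e n)) ⟩
  a + b + (e + e)
    ≲⟨ +-mono-≼ (≃⇒≼ (≃-refl {a + b})) (ptolemy (proj₁ P) (proj₂ P) (proj₁ P′) (proj₂ P′) h h′) ⟩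
  a + b + (a * d -R P′ + b * d -R P)
    ≲⟨ weighted-sum-≼ (d-R²+d--R² (proj₁ P) (proj₂ P) h) (d-R²+d--R² (proj₁ P′) (proj₂ P′) h′) ⟩
  optimum + optimum ∎)
  where
  P  = proj₁ (T zero)
  P′ = proj₁ (T (suc zero))
  h  = proj₂ (T zero)
  h′ = proj₂ (T (suc zero))
  a = d R P
  b = d R P′
  e = d P P′
  -- The final `0ℝ` is the empty sum at the end of `∑`.
  path₁ = a + (e + 0ℝ)
  path₂ = b + (d P′ P + 0ℝ)

-- The extremal pair of points.

X Y : ℝ
X = c * c - S * S
Y = 2ℝ * (S * c)

onCircle : ∀ {y} → y * y ≃ Y * Y → X * X + y * y ≃ 1ℝ
onCircle {y} h = begin-equality
  X * X + y * y                              ≈⟨ +-cong (≃-refl {X * X}) h ⟩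
  X * X + Y * Y                              ≈⟨ pointwise-≃ (λ n → solve 2 (λ S c →
    (c :* c :- S :* S) :* (c :* c :- S :* S) :+ :2 :* (S :* c) :* (:2 :* (S :* c))
    := (S :* S :+ c :* c) :* (S :* S :+ c :* c)) refl (seq S n) (seq c n)) ⟩
  (S * S + c * c) * (S * S + c * c)          ≈⟨ *-cong S²+c²≃1 S²+c²≃1 ⟩
  1ℝ * 1ℝ                                    ≈⟨ pointwise-≃ (λ _ → refl) ⟩
  1ℝ                                         ∎

-- Half-angle formula: 2 - 2X = 4S². Assuming only the square of `y` covers both (X , Y) and its
-- mirror image.
2S≼d-R : ∀ {y} → y * y ≃ Y * Y → 2ℝ * S ≼ d R (X , y)
2S≼d-R {y} h = square-cancel-≼ (0≤d R (X , y)) (≃⇒≼ (begin-equality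
  2ℝ * S * (2ℝ * S)
    ≈⟨ pointwise-≃ (λ n → solve 2 (λ S c → :2 :* S :* (:2 :* S)
         := :2 :- :2 :* (c :* c :- S :* S) :+ :2 :* (S :* S :+ c :* c :- :1)) refl (seq S n) (seq c n)) ⟩
  2ℝ - 2ℝ * X + 2ℝ * (S * S + c * c - 1ℝ)
    ≈⟨ +-*-cancel S²+c²≃1 (2ℝ - 2ℝ * X) 2ℝ ⟩
  2ℝ - 2ℝ * X
    ≈⟨ d-R-square X y (≃⇒≈ (onCircle h)) ⟨
  d R (X , y) * d R (X , y) ∎))

4Sc≼d : 4ℝ * (S * c) ≼ d (X , Y) (X , - Y)
4Sc≼d = ≼-d X Y X (- Y) (pointwise-≃ λ n → solve 2 (λ X Sc →
  :4 :* Sc :* (:4 :* Sc)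
  := (X :- X) :* (X :- X) :+ (:2 :* Sc :- :- (:2 :* Sc)) :* (:2 :* Sc :- :- (:2 :* Sc)))
  refl (seq X n) (seq (S * c) n))

-Y*-Y≃Y*Y : - Y * - Y ≃ Y * Y
-Y*-Y≃Y*Y = pointwise-≃ λ n → solve 1 (λ y → :- y :* :- y := y :* y) refl (seq Y n)

optimalPair : Fin 2 → 𝒞
optimalPair zero       = (X , Y)   , ≃⇒≈ (onCircle (≃-refl {Y * Y}))
optimalPair (suc zero) = (X , - Y) , ≃⇒≈ (onCircle -Y*-Y≃Y*Y)

-- The two points are mirror images in the axis through `R`, so the same estimate serves both orders
-- of visit.
≼-shortestPath : optimum ≼ shortestPath {1} optimalPair
≼-shortestPath = ⊓-glb-≼ (path (2S≼d-R (≃-refl {Y * Y})) 4Sc≼d)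
  (path (2S≼d-R -Y*-Y≃Y*Y) (≼-trans 4Sc≼d (≃⇒≼ (d-sym (X , Y) (X , - Y)))))
  where
  path : ∀ {a e} → 2ℝ * S ≼ a → 4ℝ * (S * c) ≼ e → optimum ≼ a + (e + 0ℝ)
  path {a} {e} h k = begin
    optimum                     ≈⟨ optimum≃2S+4Sc ⟩
    2ℝ * S + 4ℝ * (S * c)       ≲⟨ +-mono-≼ h k ⟩
    a + e                       ≈⟨ pointwise-≃ (λ n → cong (seq a n ℚ.+_) (sym (ℚ.+-identityʳ (seq e n)))) ⟩
    a + (e + 0ℝ)                ∎

lemma3 : c[ 2 ]≈ ((√ (fromℕ 33) + fromℕ 3) / 16 * √ (fromℕ 30 + fromℕ 2 * √ (fromℕ 33)))
lemma3 = record
  { upperBound = λ T → ≼⇒≤ (shortestPath-≼ T)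
  -- The supremum is attained: any upper bound dominates the value at `optimalPair`.
  ; least      = λ u h → ≼⇒≤ (≼-trans {z = u} ≼-shortestPath (mk≼ (h optimalPair)))
  }
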